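{- Let $G_1=(V_1,E_1)$ and $G_2=(V_2,E_2)$ be word-representable graphs with disjoint vertex sets, $\mathcal{R}(G_1)=k_1$, $\mathcal{R}(G_2)=k_2$, and let $x\in V_1$, $y\in V_2$, $k=\max(k_1,k_2)$. Let $G'$ be the graph with vertex set $V_1\cup V_2$ and edge set $E_1\cup E_2\cup\{(x,y)\}$, and let $G''$ be the graph obtained from $G_1$ and $G_2$ by identifying $x$ and $y$ into a single vertex $z$. Then: (1) if $|V_1|=|V_2|=1$, then $G'$ and $G''$ are complete graphs, $k_1=k_2=1$, and $\mathcal{R}(G')=\mathcal{R}(G'')=1$; (2) if $\min(|V_1|,|V_2|)=1$ and $\max(|V_1|,|V_2|)>1$, then $\mathcal{R}(G'')=k$ and $\mathcal{R}(G')=\max(k,2)$; (3) if $\min(|V_1|,|V_2|)>1$, then $\mathcal{R}(G')=\mathcal{R}(G'')=\max(k,2)$.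
   Context: All graphs are finite and simple. For a word $w$ and distinct letters $x,y$ occurring in $w$, $x$ and $y$ alternate in $w$ if deleting all letters other than copies of $x$ and $y$ yields a word of the form $xyxy\cdots$ or $yxyx\cdots$ (of even or odd length). A graph $G=(V,E)$ is word-representable if there is a word $w$ over $V$ (each vertex occurring in $w$) such that for all distinct $x,y\in V$, $x$ and $y$ alternate in $w$ iff $(x,y)\in E$. A word is $k$-uniform if each letter occurs exactly $k$ times; $G$ is $k$-word-representable if some $k$-uniform word represents it; the representation number $\mathcal{R}(G)$ is the least such $k$. -}

module Defs where

open import Data.Empty using (⊥)
open import Data.Fin using (Fin; zero; suc; punchIn; punchOut)
open import Data.Fin.Properties
  using (inj⇒≟; +↔⊎; punchIn-punchOut; punchOut-punchIn; punchOut-cong; punchInᵢ≢i)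
open import Data.List using (List; []; _∷_; filter; length)
open import Data.List.Membership.Propositional using (_∈_)
open import Data.Nat using (ℕ; zero; suc; pred; _+_; _≤_)
open import Data.Product using (Σ; ∃-syntax; _×_; _,_; proj₁; proj₂)
open import Data.Sum using (_⊎_; inj₁; inj₂)
open import Data.Sum.Function.Propositional using (_⊎-↔_)
open import Function using (_∘_)
open import Function.Bundles using (_↔_; _⇔_; mk↔ₛ′; module Inverse)
open import Function.Construct.Composition using (_↔-∘_)
open import Function.Construct.Symmetry using (↔-sym)
open import Function.Properties.Inverse using (Inverse⇒Injection)
open import Relation.Binary.Definitions using (DecidableEquality; Irreflexive; Symmetric)
open import Relation.Binary.PropositionalEquality
  using (_≡_; _≢_; refl; sym; trans; cong)
open import Relation.Nullary.Decidable using (_⊎-dec_)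

------------------------------------------------------------------------
-- Finite simple graphs

record Graph : Set₁ where
  field
    V      : Set
    order  : ℕ
    finite : V ↔ Fin order
    E      : V → V → Set
    symm   : Symmetric E
    irrefl : Irreflexive _≡_ E

  infix 4 _≟_
  _≟_ : DecidableEquality V
  _≟_ = inj⇒≟ (Inverse⇒Injection finite)

open Graph public using (V; order)

IsComplete : Graph → Set
IsComplete G = ∀ {u v} → u ≢ v → Graph.E G u v

------------------------------------------------------------------------
-- Words representing a graph

-- The word a b a b ⋯ of length n.
alternating : {A : Set} → A → A → ℕ → List A
alternating a b zero    = []
alternating a b (suc n) = a ∷ alternating b a n

module _ (G : Graph) where
  open Graph G using (E; _≟_)

  Word : Set
  Word = List (V G)

  restrict : V G → V G → Word → Word
  restrict x y = filter (λ v → (v ≟ x) ⊎-dec (v ≟ y))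

  Alternate : V G → V G → Word → Set
  Alternate x y w =
    ∃[ n ] (restrict x y w ≡ alternating x y n ⊎ restrict x y w ≡ alternating y x n)

  Represents : Word → Set
  Represents w =
    (∀ v → v ∈ w) × (∀ {x y} → x ≢ y → Alternate x y w ⇔ E x y)

  WordRepresentable : Set
  WordRepresentable = ∃[ w ] Represents w

  Uniform : ℕ → Word → Set
  Uniform k w = ∀ v → length (filter (_≟ v) w) ≡ k

  KWordRepresentable : ℕ → Set
  KWordRepresentable k = ∃[ w ] (Uniform k w × Represents w)

-- ℛ[ G ]≡ k reads ℛ(G) = k; this is a relation because ℛ(G) is defined
-- only when G is word-representable.
infix 4 ℛ[_]≡_
ℛ[_]≡_ : Graph → ℕ → Set
ℛ[ G ]≡ k = KWordRepresentable G k × (∀ j → KWordRepresentable G j → k ≤ j)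

------------------------------------------------------------------------
-- Joining two graphs by an edge

module _ (G₁ G₂ : Graph) (x : V G₁) (y : V G₂) where
  private
    module G₁ = Graph G₁
    module G₂ = Graph G₂

  -- The disjoint union of G₁ and G₂ together with the edge x y.
  connect : Graph
  connect = record
    { V      = G₁.V ⊎ G₂.V
    ; order  = G₁.order + G₂.order
    ; finite = ↔-sym +↔⊎ ↔-∘ (G₁.finite ⊎-↔ G₂.finite)
    ; E      = E′
    ; symm   = λ {u} {v} → symm′ u v
    ; irrefl = λ { {u} refl → irrefl′ u }
    }
    where
    E′ : G₁.V ⊎ G₂.V → G₁.V ⊎ G₂.V → Set
    E′ (inj₁ a) (inj₁ b) = G₁.E a b
    E′ (inj₁ a) (inj₂ b) = a ≡ x × b ≡ y
    E′ (inj₂ a) (inj₁ b) = b ≡ x × a ≡ y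
    E′ (inj₂ a) (inj₂ b) = G₂.E a b

    symm′ : ∀ u v → E′ u v → E′ v u
    symm′ (inj₁ a) (inj₁ b) e = G₁.symm e
    symm′ (inj₁ a) (inj₂ b) e = e
    symm′ (inj₂ a) (inj₁ b) e = e
    symm′ (inj₂ a) (inj₂ b) e = G₂.symm e

    irrefl′ : ∀ u → E′ u u → ⊥
    irrefl′ (inj₁ a) = G₁.irrefl refl
    irrefl′ (inj₂ a) = G₂.irrefl refl

------------------------------------------------------------------------
-- Identifying a vertex of one graph with a vertex of another

infixl 6 _∖_
_∖_ : (A : Set) → A → Set
A ∖ x = Σ A (_≢ x)

∖-finite : ∀ {A : Set} {n} → A ↔ Fin n → (x : A) → (A ∖ x) ↔ Fin (pred n)
∖-finite {n = zero} f x with () ← Inverse.to f x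
∖-finite {A} {suc n} f x = mk↔ₛ′ to′ from′ to∘from from∘to
  where
  open Inverse f

  to-≢ : ∀ {v} → v ≢ x → to x ≢ to v
  to-≢ {v} v≢x e = v≢x (trans (sym (strictlyInverseʳ v))
                         (trans (cong from (sym e)) (strictlyInverseʳ x)))

  to′ : A ∖ x → Fin n
  to′ (v , v≢x) = punchOut (to-≢ v≢x)

  from′ : Fin n → A ∖ x
  from′ j = from (punchIn (to x) j) , λ e →
    punchInᵢ≢i (to x) j (trans (sym (strictlyInverseˡ _)) (cong to e))

  to∘from : ∀ j → to′ (from′ j) ≡ j
  to∘from j = trans
    (punchOut-cong (to x) {i≢k = punchInᵢ≢i (to x) j ∘ sym} (strictlyInverseˡ _))
    (punchOut-punchIn (to x))

  -- Negations are judgementally proof irrelevant, so it suffices that the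
  -- first components agree.
  ∖-≡ : ∀ {p q : A ∖ x} → proj₁ p ≡ proj₁ q → p ≡ q
  ∖-≡ refl = refl

  from∘to : ∀ p → from′ (to′ p) ≡ p
  from∘to (v , v≢x) =
    ∖-≡ (trans (cong from (punchIn-punchOut (to-≢ v≢x))) (strictlyInverseʳ v))

-- V₁ and V₂ with x and y merged into the single vertex z.
data Merged {V₁ V₂ : Set} (x : V₁) (y : V₂) : Set where
  z  : Merged x y
  v₁ : V₁ ∖ x → Merged x y
  v₂ : V₂ ∖ y → Merged x y

Merged-finite : ∀ {V₁ V₂ : Set} {m n} → V₁ ↔ Fin m → V₂ ↔ Fin n →
                (x : V₁) (y : V₂) → Merged x y ↔ Fin (1 + (pred m + pred n))
Merged-finite {V₁} {V₂} {m} {n} f g x y = mk↔ₛ′ to′ from′ to∘from from∘to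
  where
  h : (V₁ ∖ x ⊎ V₂ ∖ y) ↔ Fin (pred m + pred n)
  h = ↔-sym +↔⊎ ↔-∘ (∖-finite f x ⊎-↔ ∖-finite g y)
  open Inverse h

  merged : V₁ ∖ x ⊎ V₂ ∖ y → Merged x y
  merged (inj₁ a) = v₁ a
  merged (inj₂ b) = v₂ b

  to′ : Merged x y → Fin (1 + (pred m + pred n))
  to′ z      = zero
  to′ (v₁ a) = suc (to (inj₁ a))
  to′ (v₂ b) = suc (to (inj₂ b))

  from′ : Fin (1 + (pred m + pred n)) → Merged x y
  from′ zero    = z
  from′ (suc i) = merged (from i)

  to′-merged : ∀ s → to′ (merged s) ≡ suc (to s)
  to′-merged (inj₁ a) = refl
  to′-merged (inj₂ b) = refl

  to∘from : ∀ i → to′ (from′ i) ≡ i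
  to∘from zero    = refl
  to∘from (suc i) = trans (to′-merged (from i)) (cong suc (strictlyInverseˡ i))

  from∘to : ∀ u → from′ (to′ u) ≡ u
  from∘to z      = refl
  from∘to (v₁ a) = cong merged (strictlyInverseʳ (inj₁ a))
  from∘to (v₂ b) = cong merged (strictlyInverseʳ (inj₂ b))

module _ (G₁ G₂ : Graph) (x : V G₁) (y : V G₂) where
  private
    module G₁ = Graph G₁
    module G₂ = Graph G₂

  identify : Graph
  identify = record
    { V      = Merged x y
    ; order  = 1 + (pred G₁.order + pred G₂.order)
    ; finite = Merged-finite G₁.finite G₂.finite x y
    ; E      = E″
    ; symm   = λ {u} {v} → symm″ u v
    ; irrefl = λ { {u} refl → irrefl″ u }
    }
    where
    E″ : Merged x y → Merged x y → Set
    E″ z            z            = ⊥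
    E″ z            (v₁ (b , _)) = G₁.E x b
    E″ z            (v₂ (b , _)) = G₂.E y b
    E″ (v₁ (a , _)) z            = G₁.E a x
    E″ (v₁ (a , _)) (v₁ (b , _)) = G₁.E a b
    E″ (v₁ _)       (v₂ _)       = ⊥
    E″ (v₂ (a , _)) z            = G₂.E a y
    E″ (v₂ _)       (v₁ _)       = ⊥
    E″ (v₂ (a , _)) (v₂ (b , _)) = G₂.E a b

    symm″ : ∀ u v → E″ u v → E″ v u
    symm″ z      (v₁ _) e = G₁.symm e
    symm″ z      (v₂ _) e = G₂.symm e
    symm″ (v₁ _) z      e = G₁.symm e
    symm″ (v₁ _) (v₁ _) e = G₁.symm e
    symm″ (v₂ _) z      e = G₂.symm e
    symm″ (v₂ _) (v₂ _) e = G₂.symm e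

    irrefl″ : ∀ u → E″ u u → ⊥
    irrefl″ (v₁ _) = G₁.irrefl refl
    irrefl″ (v₂ _) = G₂.irrefl refl

{-# OPTIONS --safe #-}
-- Deleting all letters but x and y turns a word into a sequence over Bool, and
-- x, y alternate iff no two consecutive entries of it are equal. Restriction to an
-- induced subgraph, cyclic shifts, and w ↦ p w with p the order of first
-- occurrences therefore act on representations; hence ℛ is monotone under
-- induced subgraphs and k-representability is inherited by larger k. A graph
-- is 1-representable iff it is complete, which accounts for the bound 2.
-- For k ≥ 2, shift the two words to x A₁ x A₂ ⋯ x Aₖ and y B₁ y B₂ ⋯ y Bₖ; then
-- z A₁ B₁ z B₂ A₂ z A₃ B₃ ⋯ z Aₖ Bₖ represents G″. Restricted to a in the Aᵢ and b in
-- the Bᵢ it has length 2k, whereas an alternating sequence has at most one letter per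
-- Aᵢ, and at most one in B₁B₂ together, so at most 2k - 1. Finally G′ is
-- isomorphic to what results from gluing G₁ and G₂ to the ends of K₂.
module Submission where

open import Data.Bool as Bool using (Bool; true; false; if_then_else_)
open import Data.Empty using (⊥-elim)
open import Data.Fin using (Fin; zero; suc)
open import Data.Fin.Properties using (2↔Bool)
open import Data.List
  using (List; []; _∷_; [_]; _++_; _∷ʳ_; map; mapMaybe; filter; length; deduplicate)
open import Data.List.Membership.Propositional using (_∈_)
open import Data.List.Membership.Propositional.Properties
  using (∈-filter⁻; ∈-filter⁺; ∈-length; ∈-deduplicate⁺; ∈-∃++)
open import Data.List.Properties
  using (++-assoc; ++-identityʳ; length-++; length-map; map-injective; mapMaybe-cong;
         mapMaybe-++; mapMaybe-map; mapMaybe-nothing; mapMaybe-just; map-mapMaybe; map-++;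
         ∷-injectiveˡ; filter-accept; filter-reject; filter-++)
open import Data.List.Relation.Unary.All using (All; []; _∷_)
open import Data.List.Relation.Unary.AllPairs using ([]; _∷_)
open import Data.List.Relation.Unary.Any using (here)
open import Data.List.Relation.Unary.Linked using (Linked; []; [-]; _∷_)
open import Data.List.Relation.Unary.Unique.DecPropositional.Properties using (deduplicate-!)
open import Data.Maybe using (Maybe; just; nothing; _>>=_)
open import Data.Maybe.Properties using (just-injective)
open import Data.Nat
  using (ℕ; zero; suc; _+_; _*_; _≤_; _<_; _≤′_; ≤′-refl; ≤′-step; _⊓_; _⊔_; z≤n; s≤s)
open import Data.Nat.Properties
  using (+-identityʳ; +-suc; +-comm; *-comm; ≤-refl; ≤-trans; ≤⇒≤′; suc-injective; n≤1+n; 1+n≰n;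
         ≤-antisym; ⊔-lub; m≤m⊔n; m≤n⊔m; ⊓-sel; ⊔-sel; m⊓n≤m; m⊓n≤n)
open import Data.Product using (∃-syntax; _×_; _,_; proj₁; proj₂)
open import Data.Sum using (inj₁; inj₂; isInj₁; isInj₂)
open import Data.Unit using (⊤; tt)
import Data.Unit.Properties as ⊤
open import Data.Vec using (Vec; []; _∷_)
open import Defs
open import Function using (_∘_; const; id)
open import Function.Bundles using (_⇔_; mk⇔; module Equivalence; module Inverse)
open import Function.Construct.Symmetry using (↔-sym)
open import Relation.Binary.Definitions using (DecidableEquality)
open import Relation.Binary.PropositionalEquality
  using (_≡_; _≢_; _≗_; refl; sym; trans; cong; cong₂; subst; module ≡-Reasoning)
open import Relation.Nullary using (¬_; yes; no)
open import Relation.Nullary.Decidable using (⌊_⌋; ¬?)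
open import Relation.Unary using (Decidable)

open Equivalence using (to; from)

-- Restriction of words along embeddings of alphabets.

private
  variable
    A B C D I : Set

-- Makes `f` injective and `g` its inverse, undefined exactly off the image. Thus `mapMaybe g w`
-- deletes the letters of `w` outside the image and renames the others, which is how words are
-- restricted throughout.
record PartialInverse (f : A → B) (g : B → Maybe A) : Set where
  field
    retract : ∀ a → g (f a) ≡ just a
    fibre   : ∀ {u a} → g u ≡ just a → u ≡ f a

  injective : ∀ {a b} → f a ≡ f b → a ≡ b
  injective {a} {b} e =
    just-injective (trans (sym (retract a)) (trans (cong g e) (retract b)))

  outside : ∀ {u} → (∀ a → u ≢ f a) → g u ≡ nothing
  outside {u} u≢ with g u in eq
  ... | nothing = refl
  ... | just a  = ⊥-elim (u≢ a (fibre eq))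

open PartialInverse

partialInverse-∘ : ∀ {f : A → B} {g f′ g′} → PartialInverse f g → PartialInverse {A = C} f′ g′ →
                   PartialInverse (f ∘ f′) (λ u → g u >>= g′)
partialInverse-∘ {f = f} {g} {f′} {g′} p p′ = record { retract = r ; fibre = λ {u} → φ u }
  where
  r : ∀ a → (g (f (f′ a)) >>= g′) ≡ just a
  r a rewrite retract p (f′ a) = retract p′ a

  φ : ∀ u {a} → (g u >>= g′) ≡ just a → u ≡ f (f′ a)
  φ u e with g u in eq
  ... | just b = trans (fibre p eq) (cong f (fibre p′ e))

-- The embedding determines its partial inverse, so two ways of restricting a word to the same
-- letters agree.
partialInverse-unique : ∀ {f f′ : A → B} {g g′} → f ≗ f′ →
                        PartialInverse f g → PartialInverse f′ g′ → g ≗ g′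
partialInverse-unique {g = g} {g′} f≗f′ p p′ u with g u in eq | g′ u in eq′
... | nothing | nothing = refl
... | just a  | _       = trans (sym (retract p′ a))
  (trans (cong g′ (trans (sym (f≗f′ a)) (sym (fibre p eq)))) eq′)
... | nothing | just a  = trans (sym eq)
  (trans (cong g (trans (fibre p′ eq′) (sym (f≗f′ a)))) (retract p a))

mapMaybe->>= : ∀ (g : A → Maybe B) (h : B → Maybe C) w →
               mapMaybe h (mapMaybe g w) ≡ mapMaybe (λ u → g u >>= h) w
mapMaybe->>= g h []      = refl
mapMaybe->>= g h (u ∷ w) with g u
... | nothing = mapMaybe->>= g h w
... | just b  with h b
...   | nothing = mapMaybe->>= g h w
...   | just c  = cong (c ∷_) (mapMaybe->>= g h w)

-- Bridge from the `filter`s that define counts and alternation to `mapMaybe`.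
filter-image : ∀ {f : A → B} {g} {P : B → Set} → PartialInverse f g → (P? : Decidable P) →
               (∀ a → P (f a)) → (∀ {u} → P u → ∃[ a ] u ≡ f a) →
               ∀ w → filter P? w ≡ map f (mapMaybe g w)
filter-image p P? im⊆P P⊆im []      = refl
filter-image {f = f} {g} {P} p P? im⊆P P⊆im (u ∷ w) with g u in eq
... | just a  = trans (filter-accept P? (subst P (sym (fibre p eq)) (im⊆P a)))
  (cong₂ _∷_ (fibre p eq) (filter-image p P? im⊆P P⊆im w))
... | nothing = trans (filter-reject P? ¬Pu) (filter-image p P? im⊆P P⊆im w)
  where
  ¬Pu : ¬ P u
  ¬Pu Pu with P⊆im Pu
  ... | a , refl with () ← trans (sym eq) (retract p a)

-- Letter counts and two-letter restrictions.

count : DecidableEquality A → A → List A → ℕ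
count _≟_ v w = length (filter (_≟ v) w)

module _ (_≟_ : DecidableEquality A) where

  ∈⇒count : ∀ {v w} → v ∈ w → 0 < count _≟_ v w
  ∈⇒count {v} v∈w = ∈-length (∈-filter⁺ (_≟ v) v∈w refl)

  count⇒∈ : ∀ {v} w → 0 < count _≟_ v w → v ∈ w
  count⇒∈ {v} w 0<n with filter (_≟ v) w in eq
  ... | u ∷ _ with u∈w , refl ← ∈-filter⁻ (_≟ v) {xs = w} (subst (u ∈_) (sym eq) (here refl)) = u∈w

pick : A → A → Bool → A
pick x y b = if b then x else y

module _ (_≟_ : DecidableEquality A) where

  -- Restriction to one letter, with `⊤` as alphabet: the count of `v` becomes the length of a word
  -- over `⊤`.
  only : A → A → Maybe ⊤
  only v u = if ⌊ u ≟ v ⌋ then just tt else nothing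

  only-partialInverse : ∀ v → PartialInverse (const v) (only v)
  only-partialInverse v = record { retract = r ; fibre = λ {u} → φ u }
    where
    r : ∀ a → only v v ≡ just a
    r a with v ≟ v
    ... | yes _  = refl
    ... | no v≢v = ⊥-elim (v≢v refl)

    φ : ∀ u {a} → only v u ≡ just a → u ≡ v
    φ u e with yes u≡v ← u ≟ v = u≡v

  bit : A → A → A → Maybe Bool
  bit x y u = if ⌊ u ≟ x ⌋ then just true else if ⌊ u ≟ y ⌋ then just false else nothing

  bit-partialInverse : ∀ {x y} → x ≢ y → PartialInverse (pick x y) (bit x y)
  bit-partialInverse {x} {y} x≢y = record { retract = r ; fibre = λ {u} → φ u }
    where
    r : ∀ b → bit x y (pick x y b) ≡ just b
    r true with x ≟ x
    ... | yes _  = refl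
    ... | no x≢x = ⊥-elim (x≢x refl)
    r false with y ≟ x | y ≟ y
    ... | yes y≡x | _      = ⊥-elim (x≢y (sym y≡x))
    ... | no _    | yes _  = refl
    ... | no _    | no y≢y = ⊥-elim (y≢y refl)

    φ : ∀ u {b} → bit x y u ≡ just b → u ≡ pick x y b
    φ u e with u ≟ x | u ≟ y
    φ u refl | yes u≡x | _       = u≡x
    φ u refl | no _    | yes u≡y = u≡y

  bits : A → A → List A → List Bool
  bits x y = mapMaybe (bit x y)

  length-mapMaybe-const : ∀ {v h} → PartialInverse (const v) h →
                          ∀ w → count _≟_ v w ≡ length (mapMaybe {B = ⊤} h w)
  length-mapMaybe-const {v} {h} p w = trans
    (cong length (filter-image p (_≟ v) (λ _ → refl) (λ u≡v → tt , u≡v) w))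
    (length-map _ (mapMaybe h w))

module _ (_≟A_ : DecidableEquality A) (_≟B_ : DecidableEquality B)
         {f : A → B} {g : B → Maybe A} (p : PartialInverse f g) where

  -- Both sides are lengths of words over `⊤`: restricting to the image of `f` and then to `a` is
  -- one restriction to `f a`.
  count-mapMaybe : ∀ a w → count _≟B_ (f a) w ≡ count _≟A_ a (mapMaybe g w)
  count-mapMaybe a w = trans
    (length-mapMaybe-const _≟B_ (partialInverse-∘ p (only-partialInverse _≟A_ a)) w)
    (trans (cong length (sym (mapMaybe->>= g (only _≟A_ a) w)))
      (sym (length-mapMaybe-const _≟A_ (only-partialInverse _≟A_ a) (mapMaybe g w))))

  -- By uniqueness of partial inverses, deleting other letters first makes no difference;
  -- alternation of two letters survives every restriction that keeps both.
  bits-mapMaybe : ∀ {a b} → a ≢ b → ∀ w →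
                  bits _≟B_ (f a) (f b) w ≡ bits _≟A_ a b (mapMaybe g w)
  bits-mapMaybe {a} {b} a≢b w = trans
    (mapMaybe-cong (partialInverse-unique (λ { true → refl ; false → refl })
      (bit-partialInverse _≟B_ (a≢b ∘ injective p))
      (partialInverse-∘ p (bit-partialInverse _≟A_ a≢b))) w)
    (sym (mapMaybe->>= g (bit _≟A_ a b) w))

Alternating : List Bool → Set
Alternating = Linked _≢_

countᵇ : Bool → List Bool → ℕ
countᵇ = count Bool._≟_

module _ (_≟_ : DecidableEquality A) {x y : A} (x≢y : x ≢ y) where

  count-bits : ∀ w b → countᵇ b (bits _≟_ x y w) ≡ count _≟_ (pick x y b) w
  count-bits w b = sym (count-mapMaybe Bool._≟_ _≟_ (bit-partialInverse _≟_ x≢y) b w)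

-- The order of first occurrences.

module _ (_≟A_ : DecidableEquality A) (_≟B_ : DecidableEquality B)
         {f : A → B} {g : B → Maybe A} (p : PartialInverse f g) where

  mapMaybe-remove : ∀ {u a} → g u ≡ just a → ∀ w →
    mapMaybe g (filter (¬? ∘ (u ≟B_)) w) ≡ filter (¬? ∘ (a ≟A_)) (mapMaybe g w)
  mapMaybe-remove eq []      = refl
  mapMaybe-remove {u} {a} eq (v ∷ w) with u ≟B v
  mapMaybe-remove {u} {a} eq (v ∷ w) | yes refl rewrite eq with a ≟A a
  ... | yes _  = mapMaybe-remove eq w
  ... | no a≢a = ⊥-elim (a≢a refl)
  mapMaybe-remove {u} {a} eq (v ∷ w) | no u≢v with g v in eqv
  ... | nothing = mapMaybe-remove eq w
  ... | just b with a ≟A b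
  ...   | yes refl = ⊥-elim (u≢v (trans (fibre p eq) (sym (fibre p eqv))))
  ...   | no _     = cong (b ∷_) (mapMaybe-remove eq w)

  mapMaybe-remove-nothing : ∀ {u} → g u ≡ nothing → ∀ w →
    mapMaybe g (filter (¬? ∘ (u ≟B_)) w) ≡ mapMaybe g w
  mapMaybe-remove-nothing eq []      = refl
  mapMaybe-remove-nothing {u} eq (v ∷ w) with u ≟B v
  ... | yes refl rewrite eq = mapMaybe-remove-nothing eq w
  ... | no _ with g v
  ...   | nothing = mapMaybe-remove-nothing eq w
  ...   | just b  = cong (b ∷_) (mapMaybe-remove-nothing eq w)

  -- First occurrences keep their order when other letters are deleted, so claims about
  -- `deduplicate` reduce to the alphabets `⊤` and `Bool`.
  mapMaybe-deduplicate : ∀ w → mapMaybe g (deduplicate _≟B_ w) ≡ deduplicate _≟A_ (mapMaybe g w)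
  mapMaybe-deduplicate []      = refl
  mapMaybe-deduplicate (u ∷ w) with g u in eq
  ... | nothing = trans (mapMaybe-remove-nothing eq (deduplicate _≟B_ w)) (mapMaybe-deduplicate w)
  ... | just a  = cong (a ∷_) (trans (mapMaybe-remove eq (deduplicate _≟B_ w))
    (cong (filter (¬? ∘ (a ≟A_))) (mapMaybe-deduplicate w)))

length-deduplicate-⊤ : ∀ ts → 0 < length ts → length (deduplicate ⊤._≟_ ts) ≡ 1
length-deduplicate-⊤ (t ∷ ts) _ with filter (¬? ∘ (t ⊤.≟_)) (deduplicate ⊤._≟_ ts)
                                    | deduplicate-! ⊤._≟_ (t ∷ ts)
... | []    | _                 = refl
... | _ ∷ _ | (tt≢tt ∷ _) ∷ _ = ⊥-elim (tt≢tt refl)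

-- Alternating sequences over two letters.

third-letter : ∀ {b c d : Bool} → b ≢ c → c ≢ d → b ≡ d
third-letter {true}  {true}          p q = ⊥-elim (p refl)
third-letter {true}  {false} {true}  p q = refl
third-letter {true}  {false} {false} p q = ⊥-elim (q refl)
third-letter {false} {false}         p q = ⊥-elim (p refl)
third-letter {false} {true}  {false} p q = refl
third-letter {false} {true}  {true}  p q = ⊥-elim (q refl)

length-countᵇ : ∀ s → length s ≡ countᵇ true s + countᵇ false s
length-countᵇ []          = refl
length-countᵇ (true ∷ s)  = cong suc (length-countᵇ s)
length-countᵇ (false ∷ s) = trans (cong suc (length-countᵇ s)) (sym (+-suc _ _))

-- An alternating word of even length ends in the letter it does not begin with. Evenness reads
-- `k * 2` so that each successor in `k` unfolds to two letters.
rotate-one : ∀ k {b} s → length (b ∷ s) ≡ k * 2 → Alternating (b ∷ s) → Alternating (s ∷ʳ b)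
rotate-one (suc k) (c ∷ []) _ (b≢c ∷ _) = (b≢c ∘ sym) ∷ [-]
-- Three letters are an odd number; splitting `k` further lets the equation reduce until it is
-- absurd.
rotate-one (suc zero) (c ∷ d ∷ []) ()
rotate-one (suc (suc k)) (c ∷ d ∷ []) ()
-- Since `b` equals `d`, moving `d` behind `e ∷ s` in the recursive call puts the right letter at
-- the end.
rotate-one (suc k) (c ∷ d ∷ e ∷ s) len (b≢c ∷ c≢d ∷ d≢e ∷ l) with refl ← third-letter b≢c c≢d =
  c≢d ∷ d≢e ∷ rotate-one k (e ∷ s) (suc-injective (suc-injective len)) (d≢e ∷ l)

rotate : ∀ k u v → length (u ++ v) ≡ k * 2 → Alternating (u ++ v) → Alternating (v ++ u)
rotate k []      v len l = subst Alternating (sym (++-identityʳ v)) l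
rotate k (b ∷ u) v len l = subst Alternating (++-assoc v [ b ] u)
  (rotate k u (v ∷ʳ b) len′ (subst Alternating (++-assoc u v [ b ]) (rotate-one k (u ++ v) len l)))
  where
  len′ : length (u ++ v ∷ʳ b) ≡ k * 2
  len′ = begin
    length (u ++ v ∷ʳ b)   ≡⟨ cong length (++-assoc u v [ b ]) ⟨
    length ((u ++ v) ∷ʳ b) ≡⟨ length-++ (u ++ v) ⟩
    length (u ++ v) + 1    ≡⟨ +-comm _ 1 ⟩
    suc (length (u ++ v))  ≡⟨ len ⟩
    k * 2                  ∎
    where open ≡-Reasoning

alternating-once : ∀ s → countᵇ true s ≡ 1 → countᵇ false s ≡ 1 → Alternating s
alternating-once s p q = go s p q (trans (length-countᵇ s) (cong₂ _+_ p q))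
  where
  go : ∀ s → countᵇ true s ≡ 1 → countᵇ false s ≡ 1 → length s ≡ 2 → Alternating s
  go (true  ∷ true  ∷ []) _ () _
  go (true  ∷ false ∷ []) _ _  _ = (λ ()) ∷ [-]
  go (false ∷ true  ∷ []) _ _  _ = (λ ()) ∷ [-]
  go (false ∷ false ∷ []) () _ _

alternating-++⁻ʳ : ∀ u {v} → Alternating (u ++ v) → Alternating v
alternating-++⁻ʳ []          l       = l
alternating-++⁻ʳ (b ∷ [])    {[]}    l = []
alternating-++⁻ʳ (b ∷ [])    {_ ∷ _} (_ ∷ l) = l
alternating-++⁻ʳ (b ∷ c ∷ u) (_ ∷ l) = alternating-++⁻ʳ (c ∷ u) l

-- As both letters occur, `deduplicate` yields the first letter of `s` and then the other one, after
-- which `s` starts with the former again.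
alternating-deduplicate : ∀ {s} → true ∈ s → false ∈ s → Alternating s →
                          Alternating (deduplicate Bool._≟_ s ++ s)
alternating-deduplicate {b ∷ s} t∈s f∈s l
  with filter (¬? ∘ (b Bool.≟_)) (deduplicate Bool._≟_ s) | deduplicate-! Bool._≟_ (b ∷ s)
     | ∈-deduplicate⁺ Bool._≟_ t∈s | ∈-deduplicate⁺ Bool._≟_ f∈s
... | []        | _             | here refl | here ()
... | c ∷ []    | (b≢c ∷ _) ∷ _ | _ | _ = b≢c ∷ (b≢c ∘ sym) ∷ l
... | c ∷ d ∷ _ | (b≢c ∷ b≢d ∷ _) ∷ (c≢d ∷ _) ∷ _ | _ | _ = ⊥-elim (b≢d (third-letter b≢c c≢d))

-- A second letter in the constant run `u` would repeat the first.
length-run : ∀ {c} u v → All (_≡ c) u → Alternating (u ++ v) → length (u ++ v) ≤ suc (length v)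
length-run []          v _                 _       = n≤1+n _
length-run (_ ∷ [])    v _                 _       = ≤-refl
length-run (_ ∷ _ ∷ _) v (refl ∷ refl ∷ _) (p ∷ _) = ⊥-elim (p refl)

all-mapMaybe : ∀ {c : B} (h : A → Maybe B) → (∀ p {b} → h p ≡ just b → b ≡ c) →
               ∀ d → All (_≡ c) (mapMaybe h d)
all-mapMaybe h hc []      = []
all-mapMaybe h hc (p ∷ d) with h p in eq
... | nothing = all-mapMaybe h hc d
... | just b  = hc p eq ∷ all-mapMaybe h hc d

map-alternating : ∀ (f : A → B) a b n → map f (alternating a b n) ≡ alternating (f a) (f b) n
map-alternating f a b zero    = refl
map-alternating f a b (suc n) = cong (f a ∷_) (map-alternating f b a n)

alternating-linked : ∀ {a b : A} → a ≢ b → ∀ n → Linked _≢_ (alternating a b n)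
alternating-linked a≢b zero          = []
alternating-linked a≢b (suc zero)    = [-]
alternating-linked a≢b (suc (suc n)) = a≢b ∷ alternating-linked (a≢b ∘ sym) (suc n)

linked-alternating : ∀ {b c} s → b ≢ c → Alternating (b ∷ s) → b ∷ s ≡ alternating b c (length (b ∷ s))
linked-alternating []      b≢c _         = refl
linked-alternating {b} (d ∷ s) b≢c (b≢d ∷ l) with refl ← third-letter (b≢c ∘ sym) b≢d =
  cong (b ∷_) (linked-alternating s (b≢c ∘ sym) l)

-- Uniform words representing a graph.

module _ (G : Graph) where
  open Graph G using (E; _≟_)

  -- Turns alternation into a condition on neighbouring entries, with no length or starting letter
  -- to carry along.
  alternate⇔ : ∀ {x y} → x ≢ y → ∀ w → Alternate G x y w ⇔ Alternating (bits _≟_ x y w)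
  alternate⇔ {x} {y} x≢y w = mk⇔ fwd bwd
    where
    s : List Bool
    s = bits _≟_ x y w

    f : Bool → V G
    f = pick x y

    p : PartialInverse f (bit _≟_ x y)
    p = bit-partialInverse _≟_ x≢y

    restrict≡ : restrict G x y w ≡ map f s
    restrict≡ = filter-image p _
      (λ { true → inj₁ refl ; false → inj₂ refl })
      (λ { (inj₁ u≡x) → true , u≡x ; (inj₂ u≡y) → false , u≡y }) w

    s≡ : ∀ b c n → restrict G x y w ≡ alternating (f b) (f c) n → s ≡ alternating b c n
    s≡ b c n e = map-injective (injective p)
      (trans (sym restrict≡) (trans e (sym (map-alternating f b c n))))

    fwd : Alternate G x y w → Alternating s
    fwd (n , inj₁ e) = subst Alternating (sym (s≡ true false n e)) (alternating-linked (λ ()) n)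
    fwd (n , inj₂ e) = subst Alternating (sym (s≡ false true n e)) (alternating-linked (λ ()) n)

    bwd′ : ∀ b c n → s ≡ alternating b c n → restrict G x y w ≡ alternating (f b) (f c) n
    bwd′ b c n e = trans restrict≡ (trans (cong (map f) e) (map-alternating f b c n))

    bwd : Alternating s → Alternate G x y w
    bwd l with s in eq
    ... | []        = 0 , inj₁ (bwd′ true false 0 eq)
    ... | true ∷ t  = _ , inj₁ (bwd′ true false _ (trans eq (linked-alternating t (λ ()) l)))
    ... | false ∷ t = _ , inj₂ (bwd′ false true _ (trans eq (linked-alternating t (λ ()) l)))

  -- Under uniformity, occurrence of every vertex amounts to `0 < k`; this is asked only if there is
  -- a vertex, which covers the empty graph.
  record Representation (k : ℕ) (w : List (V G)) : Set where
    field
      uniform  : ∀ v → count _≟_ v w ≡ k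
      positive : V G → 0 < k
      edges    : ∀ {x y} → x ≢ y → Alternating (bits _≟_ x y w) ⇔ E x y

  representation⁻ : ∀ {k} → KWordRepresentable G k → ∃[ w ] Representation k w
  representation⁻ (w , uni , occ , alt) = w , record
    { uniform  = uni
    ; positive = λ v → subst (0 <_) (uni v) (∈⇒count _≟_ (occ v))
    ; edges    = λ x≢y → mk⇔ (to (alt x≢y) ∘ from (alternate⇔ x≢y w))
                             (to (alternate⇔ x≢y w) ∘ from (alt x≢y))
    }

  representation⁺ : ∀ {k} w → Representation k w → KWordRepresentable G k
  representation⁺ w R = w , uniform
    , (λ v → count⇒∈ _≟_ w (subst (0 <_) (sym (uniform v)) (positive v)))
    , λ x≢y → mk⇔ (to (edges x≢y) ∘ to (alternate⇔ x≢y w))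
                  (from (alternate⇔ x≢y w) ∘ from (edges x≢y))
    where open Representation R

  length-bits : ∀ {k x y} w → (∀ v → count _≟_ v w ≡ k) → x ≢ y → length (bits _≟_ x y w) ≡ k * 2
  length-bits {k} {x} {y} w uniform x≢y = begin
    length s                            ≡⟨ length-countᵇ s ⟩
    countᵇ true s + countᵇ false s      ≡⟨ cong₂ _+_ (count-bits _≟_ x≢y w true) (count-bits _≟_ x≢y w false) ⟩
    count _≟_ x w + count _≟_ y w       ≡⟨ cong₂ _+_ (uniform x) (uniform y) ⟩
    k + k                               ≡⟨ cong (k +_) (+-identityʳ k) ⟨
    2 * k                               ≡⟨ *-comm 2 k ⟩
    k * 2                               ∎
    where
    open ≡-Reasoning
    s = bits _≟_ x y w

  rotate-bits : ∀ {k x y} u v → (∀ a → count _≟_ a (u ++ v) ≡ k) → x ≢ y →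
                Alternating (bits _≟_ x y (u ++ v)) → Alternating (bits _≟_ x y (v ++ u))
  rotate-bits {k} {x} {y} u v uniform x≢y l = subst Alternating (sym (mapMaybe-++ g v u))
    (rotate k (mapMaybe g u) (mapMaybe g v)
      (trans (cong length (sym (mapMaybe-++ g u v))) (length-bits (u ++ v) uniform x≢y))
      (subst Alternating (mapMaybe-++ g u v) l))
    where g = bit _≟_ x y

  count-swap : ∀ {a} u v → count _≟_ a (u ++ v) ≡ count _≟_ a (v ++ u)
  count-swap {a} u v = begin
    length (filter P? (u ++ v))         ≡⟨ cong length (filter-++ P? u v) ⟩
    length (filter P? u ++ filter P? v) ≡⟨ length-++ (filter P? u) ⟩
    length (filter P? u) + _            ≡⟨ +-comm (length (filter P? u)) _ ⟩
    length (filter P? v) + _            ≡⟨ length-++ (filter P? v) ⟨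
    length (filter P? v ++ filter P? u) ≡⟨ cong length (filter-++ P? v u) ⟨
    length (filter P? (v ++ u))         ∎
    where
    open ≡-Reasoning
    P? = _≟ a

  -- Uniformity gives every two-letter restriction even length, so rotation keeps alternation;
  -- rotating back gives the converse.
  rotate-representation : ∀ {k} u v → Representation k (u ++ v) → Representation k (v ++ u)
  rotate-representation u v R = record
    { uniform  = uniform′
    ; positive = positive
    ; edges    = λ x≢y → mk⇔ (to (edges x≢y) ∘ rotate-bits v u uniform′ x≢y)
                             (rotate-bits u v uniform x≢y ∘ from (edges x≢y))
    }
    where
    open Representation R
    uniform′ = λ a → trans (count-swap v u) (uniform a)

  -- An alternating pair continues to alternate across the seam, and a pair that does not alternate
  -- still fails to within the suffix `w`.
  lift-representation : ∀ {k} w → Representation k w →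
                        Representation (suc k) (deduplicate _≟_ w ++ w)
  lift-representation {k} w R = record
    { uniform  = uniform′
    ; positive = λ _ → s≤s z≤n
    ; edges    = λ {x} {y} x≢y → mk⇔
        (to (edges x≢y) ∘ alternating-++⁻ʳ _ ∘ subst Alternating (bits-lift x≢y))
        (subst Alternating (sym (bits-lift x≢y)) ∘
          alternating-deduplicate (occurs x≢y true) (occurs x≢y false) ∘ from (edges x≢y))
    }
    where
    open Representation R

    occurs : ∀ {x y} (x≢y : x ≢ y) b → b ∈ bits _≟_ x y w
    occurs {x} x≢y b = count⇒∈ Bool._≟_ _
      (subst (0 <_) (sym (trans (count-bits _≟_ x≢y w b) (uniform _))) (positive x))

    bits-lift : ∀ {x y} → x ≢ y → bits _≟_ x y (deduplicate _≟_ w ++ w) ≡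
                deduplicate Bool._≟_ (bits _≟_ x y w) ++ bits _≟_ x y w
    bits-lift {x} {y} x≢y = trans (mapMaybe-++ (bit _≟_ x y) (deduplicate _≟_ w) w)
      (cong (_++ bits _≟_ x y w) (mapMaybe-deduplicate Bool._≟_ _≟_ (bit-partialInverse _≟_ x≢y) w))

    once : ∀ v → count _≟_ v (deduplicate _≟_ w) ≡ 1
    once v = begin
      count _≟_ v (deduplicate _≟_ w)
        ≡⟨ length-mapMaybe-const _≟_ p (deduplicate _≟_ w) ⟩
      length (mapMaybe (only _≟_ v) (deduplicate _≟_ w))
        ≡⟨ cong length (mapMaybe-deduplicate ⊤._≟_ _≟_ p w) ⟩
      length (deduplicate ⊤._≟_ (mapMaybe (only _≟_ v) w))
        ≡⟨ length-deduplicate-⊤ (mapMaybe (only _≟_ v) w) (subst (0 <_)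
             (trans (sym (uniform v)) (length-mapMaybe-const _≟_ p w)) (positive v)) ⟩
      1 ∎
      where
      open ≡-Reasoning
      p = only-partialInverse _≟_ v

    uniform′ : ∀ v → count _≟_ v (deduplicate _≟_ w ++ w) ≡ suc k
    uniform′ v = begin
      count _≟_ v (deduplicate _≟_ w ++ w)
        ≡⟨ cong length (filter-++ (_≟ v) (deduplicate _≟_ w) w) ⟩
      length (filter (_≟ v) (deduplicate _≟_ w) ++ filter (_≟ v) w)
        ≡⟨ length-++ (filter (_≟ v) (deduplicate _≟_ w)) ⟩
      count _≟_ v (deduplicate _≟_ w) + count _≟_ v w
        ≡⟨ cong₂ _+_ (once v) (uniform v) ⟩
      suc k ∎
      where open ≡-Reasoning

  representable-mono : ∀ {j k} → j ≤ k → KWordRepresentable G j → KWordRepresentable G k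
  representable-mono j≤k = go (≤⇒≤′ j≤k)
    where
    go : ∀ {j k} → j ≤′ k → KWordRepresentable G j → KWordRepresentable G k
    go ≤′-refl       r = r
    go (≤′-step j≤k) r with w , R ← representation⁻ (go j≤k r) =
      representation⁺ _ (lift-representation w R)

  -- Letters occurring once each leave only `xy` or `yx`.
  1-uniform-alternating : ∀ w → (∀ v → count _≟_ v w ≡ 1) →
                          ∀ {x y} → x ≢ y → Alternating (bits _≟_ x y w)
  1-uniform-alternating w uniform x≢y = alternating-once _
    (trans (count-bits _≟_ x≢y w true) (uniform _)) (trans (count-bits _≟_ x≢y w false) (uniform _))

  1-representable⇒complete : KWordRepresentable G 1 → IsComplete G
  1-representable⇒complete r x≢y with w , R ← representation⁻ r =
    to (edges x≢y) (1-uniform-alternating w uniform x≢y)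
    where open Representation R

  representable⇒positive : ∀ {k} → V G → KWordRepresentable G k → 0 < k
  representable⇒positive v r with w , R ← representation⁻ r = Representation.positive R v

-- Induced subgraphs.

record Embedding (H G : Graph) : Set where
  field
    emb            : V H → V G
    proj           : V G → Maybe (V H)
    partialInverse : PartialInverse emb proj
    edges          : ∀ a b → Graph.E H a b ⇔ Graph.E G (emb a) (emb b)

module _ {H G : Graph} (i : Embedding H G) where
  private
    module H = Graph H
    module G = Graph G
  open Embedding i

  -- Deleting the letters outside the image of `H` changes neither the counts nor the alternation of
  -- those that remain.
  embed : ∀ {k} → KWordRepresentable G k → KWordRepresentable H k
  embed r with w , R ← representation⁻ G r = representation⁺ H (mapMaybe proj w) record
    { uniform  = λ v → trans (sym (count-mapMaybe H._≟_ G._≟_ partialInverse v w)) (uniform (emb v))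
    ; positive = positive ∘ emb
    ; edges    = λ {a} {b} a≢b →
        let e    = alternating⇔E (a≢b ∘ injective partialInverse)
            same = bits-mapMaybe H._≟_ G._≟_ partialInverse a≢b w
        in mk⇔ (from (edges a b) ∘ to e ∘ subst Alternating (sym same))
               (subst Alternating same ∘ from e ∘ to (edges a b))
    }
    where open Representation R renaming (edges to alternating⇔E)

  module _ {k} w (R : Representation H k (mapMaybe proj w)) where

    -- Converse use of an embedding: a restriction of `w` that represents `H` controls `w` on the
    -- image. The hypothesis is on `proj` because that computes on the constructors of merged
    -- vertices, where `emb` waits for a vertex comparison.
    embedded-uniform : ∀ u {a} → proj u ≡ just a → count G._≟_ u w ≡ k
    embedded-uniform u {a} e rewrite fibre partialInverse e =
      trans (count-mapMaybe H._≟_ G._≟_ partialInverse a w) (Representation.uniform R a)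

    embedded-edges : ∀ u v {a b} → proj u ≡ just a → proj v ≡ just b → u ≢ v →
                     Alternating (bits G._≟_ u v w) ⇔ H.E a b
    embedded-edges u v {a} {b} e e′ u≢v rewrite fibre partialInverse e | fibre partialInverse e′ =
      mk⇔ (to (Representation.edges R a≢b) ∘ subst Alternating same)
          (subst Alternating (sym same) ∘ from (Representation.edges R a≢b))
      where
      a≢b : a ≢ b
      a≢b = u≢v ∘ cong emb
      same = bits-mapMaybe H._≟_ G._≟_ partialInverse a≢b w

embedding-∘ : ∀ {G H K} → Embedding H G → Embedding K H → Embedding K G
embedding-∘ i j = record
  { emb            = I.emb ∘ J.emb
  ; proj           = λ u → I.proj u >>= J.proj
  ; partialInverse = partialInverse-∘ I.partialInverse J.partialInverse
  ; edges          = λ a b → mk⇔ (to (I.edges _ _) ∘ to (J.edges a b))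
                                 (from (J.edges a b) ∘ from (I.edges _ _))
  }
  where
  module I = Embedding i
  module J = Embedding j

-- Words cut into blocks at a letter.

unblock : (x : A) → ∀ {k} → Vec (List (A ∖ x)) k → List A
unblock x []       = []
unblock x (b ∷ bs) = x ∷ map proj₁ b ++ unblock x bs

blocks : (_≟_ : DecidableEquality A) → ∀ x w →
         ∃[ b ] ∃[ bs ] w ≡ map proj₁ b ++ unblock x {count _≟_ x w} bs
blocks _≟_ x []      = [] , [] , refl
blocks _≟_ x (u ∷ w) with blocks _≟_ x w | u ≟ x
... | b , bs , eq | yes refl = [] , b ∷ bs , cong (x ∷_) eq
... | b , bs , eq | no u≢x   = (u , u≢x) ∷ b , bs , cong (u ∷_) eq

-- Rotating to an occurrence of `x` leaves nothing before the first `x`, and uniformity fixes the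
-- number of blocks at `k`.
rotate-to : ∀ G {k w} (x : V G) → Representation G k w → ∃[ bs ] Representation G k (unblock x {k} bs)
rotate-to G {k} {w} x R
  with u , v , refl ← ∈-∃++ (count⇒∈ (Graph._≟_ G) w
         (subst (0 <_) (sym (Representation.uniform R x)) (Representation.positive R x)))
  with blocks (Graph._≟_ G) x (x ∷ v ++ u) | rotate-representation G u (x ∷ v) R
... | (a , a≢x) ∷ b , bs , eq | _  = ⊥-elim (a≢x (sym (∷-injectiveˡ eq)))
... | []            , bs , eq | R′ =
  subst (λ n → ∃[ bs ] Representation G k (unblock x {n} bs)) (Representation.uniform R′ x)
    (bs , subst (Representation G k) eq R′)

mapMaybe-append : ∀ (g : C → Maybe D) (v : I → C) d {w s} → mapMaybe g w ≡ s →
                  mapMaybe g (map v d ++ w) ≡ mapMaybe (g ∘ v) d ++ s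
mapMaybe-append g v d {w} eq = trans (mapMaybe-++ g (map v d) w)
  (cong₂ _++_ (mapMaybe-map g v d) eq)

keep : ∀ (g : C → Maybe D) (v : I → C) (f : I → D) → g ∘ v ≗ just ∘ f →
       ∀ d {w s} → mapMaybe g w ≡ s → mapMaybe g (map v d ++ w) ≡ map f d ++ s
keep g v f gv d {s = s} eq = trans (mapMaybe-append g v d eq)
  (cong (_++ s) (trans (mapMaybe-cong gv d)
    (trans (sym (map-mapMaybe f just d)) (cong (map f) (mapMaybe-just d)))))

skip : ∀ (g : C → Maybe D) (v : I → C) → g ∘ v ≗ const nothing →
       ∀ d {w s} → mapMaybe g w ≡ s → mapMaybe g (map v d ++ w) ≡ s
skip g v gv d {s = s} eq = trans (mapMaybe-append g v d eq)
  (cong (_++ s) (trans (mapMaybe-cong gv d) (mapMaybe-nothing d)))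

-- The glued word and its restrictions.

module _ {x : A} {y : B} where

  interleave : ∀ {n} → Vec (List (A ∖ x)) n → Vec (List (B ∖ y)) n → List (Merged x y)
  interleave []       []       = []
  interleave (a ∷ as) (b ∷ bs) = z ∷ map v₁ a ++ map v₂ b ++ interleave as bs

  -- The order within the second pair of blocks is reversed, which brings two
  -- blocks of B together: this spoils the alternation of A ∖ x with B ∖ y.
  glue : ∀ {n} → Vec (List (A ∖ x)) (2 + n) → Vec (List (B ∖ y)) (2 + n) → List (Merged x y)
  glue (a ∷ a′ ∷ as) (b ∷ b′ ∷ bs) =
    z ∷ map v₁ a ++ map v₂ b ++ z ∷ map v₂ b′ ++ map v₁ a′ ++ interleave as bs

  project-left : Merged x y → Maybe A
  project-left z            = just x
  project-left (v₁ (a , _)) = just a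
  project-left (v₂ _)       = nothing

  swap : Merged x y → Merged y x
  swap z      = z
  swap (v₁ a) = v₂ a
  swap (v₂ b) = v₁ b

module _ {x : A} {y : B} where

  private
    left : Merged x y → Maybe A
    left = project-left

    right : Merged x y → Maybe B
    right = project-left ∘ swap

    keep₁ : ∀ (a : List (A ∖ x)) {w s} → mapMaybe left w ≡ s → mapMaybe left (map v₁ a ++ w) ≡ map proj₁ a ++ s
    keep₁ = keep left v₁ proj₁ (λ _ → refl)

    skip₁ : ∀ (b : List (B ∖ y)) {w s} → mapMaybe left w ≡ s → mapMaybe left (map v₂ b ++ w) ≡ s
    skip₁ = skip left v₂ (λ _ → refl)

    keep₂ : ∀ (b : List (B ∖ y)) {w s} → mapMaybe right w ≡ s → mapMaybe right (map v₂ b ++ w) ≡ map proj₁ b ++ s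
    keep₂ = keep right v₂ proj₁ (λ _ → refl)

    skip₂ : ∀ (a : List (A ∖ x)) {w s} → mapMaybe right w ≡ s → mapMaybe right (map v₁ a ++ w) ≡ s
    skip₂ = skip right v₁ (λ _ → refl)

  interleave-left : ∀ {n} as (bs : Vec _ n) → mapMaybe left (interleave as bs) ≡ unblock x as
  interleave-left []       []       = refl
  interleave-left (a ∷ as) (b ∷ bs) = cong (x ∷_) (keep₁ a (skip₁ b (interleave-left as bs)))

  interleave-right : ∀ {n} (as : Vec _ n) bs → mapMaybe right (interleave as bs) ≡ unblock y bs
  interleave-right []       []       = refl
  interleave-right (a ∷ as) (b ∷ bs) = cong (y ∷_) (skip₂ a (keep₂ b (interleave-right as bs)))

  -- The projection erases one block of every pair, so it does not see the reversed order in the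
  -- second pair.
  glue-left : ∀ {n} as (bs : Vec _ (2 + n)) → mapMaybe left (glue as bs) ≡ unblock x as
  glue-left (a ∷ a′ ∷ as) (b ∷ b′ ∷ bs) = cong (x ∷_) (keep₁ a (skip₁ b (cong (x ∷_)
    (skip₁ b′ (keep₁ a′ (interleave-left as bs))))))

  glue-right : ∀ {n} (as : Vec _ (2 + n)) bs → mapMaybe right (glue as bs) ≡ unblock y bs
  glue-right (a ∷ a′ ∷ as) (b ∷ b′ ∷ bs) = cong (y ∷_) (skip₂ a (keep₂ b (cong (y ∷_)
    (keep₂ b′ (skip₂ a′ (interleave-right as bs))))))

  module _ {g : Merged x y → Maybe Bool} {c d : Bool} (gz : g z ≡ nothing)
           (g₁ : ∀ p {b} → g (v₁ p) ≡ just b → b ≡ c)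
           (g₂ : ∀ p {b} → g (v₂ p) ≡ just b → b ≡ d) where

    -- Meant for `g` the restriction to one letter of `A ∖ x` and one of `B ∖ y`. The record lets
    -- `w` be inferred, which `mapMaybe g w` does not determine.
    record Bounded (n : ℕ) (w : List (Merged x y)) : Set where
      constructor bounded
      field bound : Alternating (mapMaybe g w) → length (mapMaybe g w) ≤ n

    bounded-z : ∀ {n w} → Bounded n w → Bounded n (z ∷ w)
    bounded-z {n} {w} (bounded β) = bounded β′
      where
      β′ : Alternating (mapMaybe g (z ∷ w)) → length (mapMaybe g (z ∷ w)) ≤ n
      β′ rewrite gz = β

    bounded-run : ∀ {n b} (v : D → Merged x y) → (∀ p {b′} → g (v p) ≡ just b′ → b′ ≡ b) →
                  ∀ d {w} → Bounded n w → Bounded (suc n) (map v d ++ w)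
    bounded-run {n = n} v gv d {w} (bounded β) = bounded β′
      where
      β′ : Alternating (mapMaybe g (map v d ++ w)) → length (mapMaybe g (map v d ++ w)) ≤ suc n
      β′ l rewrite mapMaybe-append g v d {w} refl = ≤-trans
        (length-run (mapMaybe (g ∘ v) d) (mapMaybe g w) (all-mapMaybe (g ∘ v) gv d) l)
        (s≤s (β (alternating-++⁻ʳ (mapMaybe (g ∘ v) d) l)))

    interleave-bounded : ∀ {n} as (bs : Vec _ n) → Bounded (n * 2) (interleave as bs)
    interleave-bounded []       []       = bounded λ _ → z≤n
    interleave-bounded (a ∷ as) (b ∷ bs) =
      bounded-z (bounded-run v₁ g₁ a (bounded-run v₂ g₂ b (interleave-bounded as bs)))

    -- One letter for `a`, one for `b` and `b′` together, one for `a′`, and two for each later pair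
    -- of blocks.
    glue-bounded : ∀ {n} as (bs : Vec _ (2 + n)) → Bounded (3 + n * 2) (glue as bs)
    glue-bounded {n} (a ∷ a′ ∷ as) (b ∷ b′ ∷ bs) = bounded-z (bounded-run v₁ g₁ a
      -- The `z` between `b` and `b′` is erased by `g`, so both blocks form a single run.
      (bounded (subst (λ s → Alternating s → length s ≤ 2 + n * 2) merge
        (Bounded.bound (bounded-run v₂ g₂ (b ++ b′)
          (bounded-run v₁ g₁ a′ (interleave-bounded as bs)))))))
      where
      rest = map v₁ a′ ++ interleave as bs

      merge : mapMaybe g (map v₂ (b ++ b′) ++ rest) ≡ mapMaybe g (map v₂ b ++ z ∷ map v₂ b′ ++ rest)
      merge rewrite map-++ (v₂ {x = x} {y}) b b′ | ++-assoc (map (v₂ {x = x} {y}) b) (map v₂ b′) rest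
                  | mapMaybe-++ g (map v₂ b) (map v₂ b′ ++ rest)
                  | mapMaybe-++ g (map v₂ b) (z ∷ map v₂ b′ ++ rest)
                  | gz = refl

-- Both graphs as induced subgraphs of their identification.

module _ (G₁ G₂ : Graph) (x : V G₁) (y : V G₂) where
  private
    module G₁ = Graph G₁
    module G₂ = Graph G₂
    module G″ = Graph (identify G₁ G₂ x y)

  embed-left : V G₁ → Merged x y
  embed-left a with a G₁.≟ x
  ... | yes _  = z
  ... | no a≢x = v₁ (a , a≢x)

  embed-left-x : embed-left x ≡ z
  embed-left-x with x G₁.≟ x
  ... | yes _  = refl
  ... | no x≢x = ⊥-elim (x≢x refl)

  embed-left-v₁ : ∀ a a≢x → embed-left a ≡ v₁ (a , a≢x)
  embed-left-v₁ a a≢x with a G₁.≟ x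
  ... | yes a≡x = ⊥-elim (a≢x a≡x)
  ... | no _    = refl

  left-embedding : Embedding G₁ (identify G₁ G₂ x y)
  left-embedding = record
    { emb            = embed-left
    ; proj           = project-left
    ; partialInverse = record { retract = r ; fibre = λ {u} → φ u }
    ; edges          = e
    }
    where
    r : ∀ a → project-left (embed-left a) ≡ just a
    r a with a G₁.≟ x
    ... | yes refl = refl
    ... | no _     = refl

    φ : ∀ u {a} → project-left u ≡ just a → u ≡ embed-left a
    φ z              refl = sym embed-left-x
    φ (v₁ (a , a≢x)) refl = sym (embed-left-v₁ a a≢x)

    e : ∀ a b → G₁.E a b ⇔ G″.E (embed-left a) (embed-left b)
    e a b with a G₁.≟ x | b G₁.≟ x
    ... | yes refl | yes refl = mk⇔ (G₁.irrefl refl) (λ ())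
    ... | yes refl | no _     = mk⇔ id id
    ... | no _     | yes refl = mk⇔ id id
    ... | no _     | no _     = mk⇔ id id

-- Identification is symmetric up to `swap`, so what holds for the first graph transfers to the
-- second.
swap-embedding : ∀ G₁ G₂ x y → Embedding (identify G₁ G₂ x y) (identify G₂ G₁ y x)
swap-embedding G₁ G₂ x y = record
  { emb            = swap
  ; proj           = just ∘ swap
  ; partialInverse = record
    { retract = cong just ∘ swap-involutive
    ; fibre   = λ {u} e → trans (sym (swap-involutive u)) (cong swap (just-injective {x = swap u} e))
    }
  ; edges          = e
  }
  where
  swap-involutive : ∀ {A B : Set} {x : A} {y : B} (u : Merged x y) → swap (swap u) ≡ u
  swap-involutive z      = refl
  swap-involutive (v₁ _) = refl
  swap-involutive (v₂ _) = refl

  e : ∀ u v → Graph.E (identify G₁ G₂ x y) u v ⇔ Graph.E (identify G₂ G₁ y x) (swap u) (swap v)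
  e z      z      = mk⇔ id id
  e z      (v₁ _) = mk⇔ id id
  e z      (v₂ _) = mk⇔ id id
  e (v₁ _) z      = mk⇔ id id
  e (v₁ _) (v₁ _) = mk⇔ id id
  e (v₁ _) (v₂ _) = mk⇔ id id
  e (v₂ _) z      = mk⇔ id id
  e (v₂ _) (v₁ _) = mk⇔ id id
  e (v₂ _) (v₂ _) = mk⇔ id id

right-embedding : ∀ G₁ G₂ x y → Embedding G₂ (identify G₁ G₂ x y)
right-embedding G₁ G₂ x y = embedding-∘ (swap-embedding G₂ G₁ y x) (left-embedding G₂ G₁ y x)

-- Representing the identification.

module _ (G₁ G₂ : Graph) (x : V G₁) (y : V G₂) where
  private
    module G″ = Graph (identify G₁ G₂ x y)
    i₁ = left-embedding G₁ G₂ x y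
    i₂ = right-embedding G₁ G₂ x y

  -- Pairs within one graph, `z` included, are settled by the projection to it; the pairs across are
  -- nonadjacent and must fail to alternate.
  glue-representation : ∀ {n as bs} → Representation G₁ (2 + n) (unblock x as) →
                        Representation G₂ (2 + n) (unblock y bs) →
                        Representation (identify G₁ G₂ x y) (2 + n) (glue as bs)
  glue-representation {n} {as} {bs} R₁ R₂ = record
    { uniform  = uniform
    ; positive = λ _ → s≤s z≤n
    ; edges    = λ {u} {v} → edges u v
    }
    where
    w = glue as bs

    R₁′ : Representation G₁ (2 + n) (mapMaybe project-left w)
    R₁′ = subst (Representation G₁ (2 + n)) (sym (glue-left as bs)) R₁

    R₂′ : Representation G₂ (2 + n) (mapMaybe (project-left ∘ swap) w)
    R₂′ = subst (Representation G₂ (2 + n)) (sym (glue-right as bs)) R₂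

    uniform : ∀ u → count G″._≟_ u w ≡ 2 + n
    uniform z        = embedded-uniform i₁ w R₁′ z refl
    uniform u@(v₁ _) = embedded-uniform i₁ w R₁′ u refl
    uniform u@(v₂ _) = embedded-uniform i₂ w R₂′ u refl

    -- The bits `c` and `d` record which of `u` and `v` lies in the first and which in the second
    -- graph. Uniformity demands `4 + n * 2` letters, one more than an alternating restriction can
    -- have.
    cross : ∀ u v c d → u ≢ v →
            (∀ b → z ≢ pick u v b) →
            (∀ p b → v₁ p ≡ pick u v b → b ≡ c) →
            (∀ q b → v₂ q ≡ pick u v b → b ≡ d) →
            ¬ Alternating (bits G″._≟_ u v w)
    cross u v c d u≢v z≢ c! d! l = 1+n≰n (subst (_≤ 3 + n * 2)
      (length-bits (identify G₁ G₂ x y) w uniform u≢v)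
      (Bounded.bound (glue-bounded {g = bit G″._≟_ u v} {c = c} {d = d} (outside π z≢)
        (λ p e → c! p _ (fibre π e)) (λ q e → d! q _ (fibre π e)) {n} as bs) l))
      where π = bit-partialInverse G″._≟_ u≢v

    edges : ∀ u v → u ≢ v → Alternating (bits G″._≟_ u v w) ⇔ G″.E u v
    edges z        z        z≢z = ⊥-elim (z≢z refl)
    edges z        v@(v₁ _) = embedded-edges i₁ w R₁′ z v refl refl
    edges z        v@(v₂ _) = embedded-edges i₂ w R₂′ z v refl refl
    edges u@(v₁ _) z        = embedded-edges i₁ w R₁′ u z refl refl
    edges u@(v₁ _) v@(v₁ _) = embedded-edges i₁ w R₁′ u v refl refl
    edges u@(v₁ _) v@(v₂ _) u≢v = mk⇔ (cross u v true false u≢v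
      (λ { true () ; false () }) (λ { _ true _ → refl ; _ false () }) (λ { _ true () ; _ false _ → refl })) (λ ())
    edges u@(v₂ _) z        = embedded-edges i₂ w R₂′ u z refl refl
    edges u@(v₂ _) v@(v₁ _) u≢v = mk⇔ (cross u v false true u≢v
      (λ { true () ; false () }) (λ { _ true () ; _ false _ → refl }) (λ { _ true _ → refl ; _ false () })) (λ ())
    edges u@(v₂ _) v@(v₂ _) = embedded-edges i₂ w R₂′ u v refl refl

identify-representable : ∀ G₁ G₂ x y {k} → 2 ≤ k → KWordRepresentable G₁ k → KWordRepresentable G₂ k →
                         KWordRepresentable (identify G₁ G₂ x y) k
-- Matching on `2 ≤ k` exhibits the two pairs of blocks that `glue` treats specially.
identify-representable G₁ G₂ x y (s≤s (s≤s _)) r₁ r₂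
  with _ , R₁ ← representation⁻ G₁ r₁ | _ , R₂ ← representation⁻ G₂ r₂
  with as , R₁′ ← rotate-to G₁ x R₁ | bs , R₂′ ← rotate-to G₂ y R₂ =
  representation⁺ (identify G₁ G₂ x y) (glue as bs) (glue-representation G₁ G₂ x y {as = as} {bs} R₁′ R₂′)

-- Joining by an edge as a double identification with `K₂`.

K₂ : Graph
K₂ = record
  { V      = Bool
  ; order  = 2
  ; finite = ↔-sym 2↔Bool
  ; E      = _≢_
  ; symm   = λ p → p ∘ sym
  ; irrefl = λ p q → q p
  }

K₂-representable : KWordRepresentable K₂ 1
K₂-representable = representation⁺ K₂ w record
  { uniform  = uniform
  ; positive = λ _ → s≤s z≤n
  ; edges    = λ a≢b → mk⇔ (const a≢b) (const (1-uniform-alternating K₂ w uniform a≢b))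
  }
  where
  w = true ∷ false ∷ []

  uniform : ∀ v → count (Graph._≟_ K₂) v w ≡ 1
  uniform true  = refl
  uniform false = refl

module _ (G₁ G₂ : Graph) (x : V G₁) (y : V G₂) where
  private
    module G₁ = Graph G₁
    module G₂ = Graph G₂
    G′ = connect G₁ G₂ x y
    G″ = identify G₁ G₂ x y
    module G′ = Graph G′
    module G″ = Graph G″

  connect-left : Embedding G₁ G′
  connect-left = record
    { emb            = inj₁
    ; proj           = isInj₁
    ; partialInverse = record { retract = λ _ → refl ; fibre = λ { {inj₁ _} refl → refl } }
    ; edges          = λ _ _ → mk⇔ id id
    }

  connect-right : Embedding G₂ G′
  connect-right = record
    { emb            = inj₂
    ; proj           = isInj₂
    ; partialInverse = record { retract = λ _ → refl ; fibre = λ { {inj₂ _} refl → refl } }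
    ; edges          = λ _ _ → mk⇔ id id
    }

  -- `true` is merged with `x` and `false` with `y`, so the edge of `K₂` becomes the one that joins
  -- the graphs.
  G₁-K₂-G₂ : Graph
  G₁-K₂-G₂ = identify (identify G₁ K₂ x true) G₂ (v₂ (false , λ ())) y

  connect-embedding : Embedding G′ G₁-K₂-G₂
  connect-embedding = record
    { emb            = emb
    ; proj           = proj
    ; partialInverse = record { retract = retract′ ; fibre = λ {u} → fibre′ u }
    ; edges          = edges
    }
    where
    emb : V G′ → V G₁-K₂-G₂
    emb (inj₁ a) with a G₁.≟ x
    ... | yes _  = v₁ (z , λ ())
    ... | no a≢x = v₁ (v₁ (a , a≢x) , λ ())
    emb (inj₂ b) with b G₂.≟ y
    ... | yes _  = z
    ... | no b≢y = v₂ (b , b≢y)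

    proj : V G₁-K₂-G₂ → Maybe (V G′)
    proj z                       = just (inj₂ y)
    proj (v₁ (z , _))            = just (inj₁ x)
    proj (v₁ (v₁ (a , _) , _))   = just (inj₁ a)
    -- A default: the only vertex of `K₂` besides `true` is `false`, which has been merged with `y`.
    proj (v₁ (v₂ _ , _))         = nothing
    proj (v₂ (b , _))            = just (inj₂ b)

    retract′ : ∀ u → proj (emb u) ≡ just u
    retract′ (inj₁ a) with a G₁.≟ x
    ... | yes refl = refl
    ... | no _     = refl
    retract′ (inj₂ b) with b G₂.≟ y
    ... | yes refl = refl
    ... | no _     = refl

    fibre′ : ∀ u {a} → proj u ≡ just a → u ≡ emb a
    fibre′ z refl with y G₂.≟ y
    ... | yes _  = refl
    ... | no y≢y = ⊥-elim (y≢y refl)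
    fibre′ (v₁ (z , _)) refl with x G₁.≟ x
    ... | yes _  = refl
    ... | no x≢x = ⊥-elim (x≢x refl)
    fibre′ (v₁ (v₁ (a , a≢x) , _)) refl with a G₁.≟ x
    ... | yes a≡x = ⊥-elim (a≢x a≡x)
    ... | no _    = refl
    fibre′ (v₂ (b , b≢y)) refl with b G₂.≟ y
    ... | yes b≡y = ⊥-elim (b≢y b≡y)
    ... | no _    = refl

    edges : ∀ u v → G′.E u v ⇔ Graph.E G₁-K₂-G₂ (emb u) (emb v)
    edges (inj₁ a) (inj₁ b) with a G₁.≟ x | b G₁.≟ x
    ... | yes refl | yes refl = mk⇔ (G₁.irrefl refl) (λ ())
    ... | yes refl | no _     = mk⇔ id id
    ... | no _     | yes refl = mk⇔ id id
    ... | no _     | no _     = mk⇔ id id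
    edges (inj₁ a) (inj₂ b) with a G₁.≟ x | b G₂.≟ y
    -- Here the edge on the right unfolds to that of `K₂`, namely `true ≢ false`.
    ... | yes a≡x | yes b≡y = mk⇔ (λ _ ()) (λ _ → a≡x , b≡y)
    ... | yes _   | no b≢y  = mk⇔ (b≢y ∘ proj₂) (λ ())
    ... | no a≢x  | yes _   = mk⇔ (a≢x ∘ proj₁) (λ ())
    ... | no a≢x  | no _    = mk⇔ (a≢x ∘ proj₁) (λ ())
    edges (inj₂ b) (inj₁ a) with b G₂.≟ y | a G₁.≟ x
    ... | yes b≡y | yes a≡x = mk⇔ (λ _ ()) (λ _ → a≡x , b≡y)
    ... | no b≢y  | yes _   = mk⇔ (b≢y ∘ proj₂) (λ ())
    ... | yes _   | no a≢x  = mk⇔ (a≢x ∘ proj₁) (λ ())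
    ... | no _    | no a≢x  = mk⇔ (a≢x ∘ proj₁) (λ ())
    edges (inj₂ a) (inj₂ b) with a G₂.≟ y | b G₂.≟ y
    ... | yes refl | yes refl = mk⇔ (G₂.irrefl refl) (λ ())
    ... | yes refl | no _     = mk⇔ id id
    ... | no _     | yes refl = mk⇔ id id
    ... | no _     | no _     = mk⇔ id id

  connect-representable : ∀ {k} → 2 ≤ k → KWordRepresentable G₁ k → KWordRepresentable G₂ k →
                          KWordRepresentable G′ k
  connect-representable 2≤k r₁ r₂ = embed connect-embedding
    (identify-representable (identify G₁ K₂ x true) G₂ _ y 2≤k
      (identify-representable G₁ K₂ x true 2≤k r₁
        (representable-mono K₂ (≤-trans (s≤s z≤n) 2≤k) K₂-representable))
      r₂)

  -- Graphs with a single vertex.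

  singleton-connect : (∀ a → a ≡ x) → (∀ b → b ≡ y) → Embedding G′ K₂
  singleton-connect ≡x ≡y = record
    { emb            = λ { (inj₁ _) → true ; (inj₂ _) → false }
    ; proj           = λ { true → just (inj₁ x) ; false → just (inj₂ y) }
    ; partialInverse = record
      { retract = λ { (inj₁ a) → cong (just ∘ inj₁) (sym (≡x a)) ; (inj₂ b) → cong (just ∘ inj₂) (sym (≡y b)) }
      ; fibre   = λ { {true} refl → refl ; {false} refl → refl }
      }
    ; edges          = λ
      { (inj₁ a) (inj₁ b) → mk⇔ (λ e → ⊥-elim (G₁.irrefl (trans (≡x a) (sym (≡x b))) e))
                                (λ t≢t → ⊥-elim (t≢t refl))
      ; (inj₁ a) (inj₂ b) → mk⇔ (λ _ ()) (λ _ → ≡x a , ≡y b)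
      ; (inj₂ b) (inj₁ a) → mk⇔ (λ _ ()) (λ _ → ≡x a , ≡y b)
      ; (inj₂ a) (inj₂ b) → mk⇔ (λ e → ⊥-elim (G₂.irrefl (trans (≡y a) (sym (≡y b))) e))
                                (λ f≢f → ⊥-elim (f≢f refl))
      }
    }

  -- With `y` alone in `G₂` nothing is added to `G₁`, and `embed-left` is a two-sided inverse.
  singleton-identify : (∀ b → b ≡ y) → Embedding G″ G₁
  singleton-identify ≡y = record
    { emb            = emb
    ; proj           = just ∘ embed-left G₁ G₂ x y
    ; partialInverse = record
      { retract = cong just ∘ retract′
      ; fibre   = λ e → trans (sym (emb-embed-left _)) (cong emb (just-injective e))
      }
    ; edges          = edges
    }
    where
    emb : V G″ → V G₁
    emb z            = x
    emb (v₁ (a , _)) = a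
    emb (v₂ (b , b≢y)) = ⊥-elim (b≢y (≡y b))

    retract′ : ∀ u → embed-left G₁ G₂ x y (emb u) ≡ u
    retract′ z              = embed-left-x G₁ G₂ x y
    retract′ (v₁ (a , a≢x)) = embed-left-v₁ G₁ G₂ x y a a≢x
    retract′ (v₂ (b , b≢y)) = ⊥-elim (b≢y (≡y b))

    emb-embed-left : ∀ a → emb (embed-left G₁ G₂ x y a) ≡ a
    emb-embed-left a with a G₁.≟ x
    ... | yes a≡x = sym a≡x
    ... | no _    = refl

    edges : ∀ u v → G″.E u v ⇔ G₁.E (emb u) (emb v)
    edges z              z              = mk⇔ (λ ()) (G₁.irrefl refl)
    edges z              (v₁ _)         = mk⇔ id id
    edges (v₁ _)         z              = mk⇔ id id
    edges (v₁ _)         (v₁ _)         = mk⇔ id id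
    edges (v₂ (b , b≢y)) _              = ⊥-elim (b≢y (≡y b))
    edges z              (v₂ (b , b≢y)) = ⊥-elim (b≢y (≡y b))
    edges (v₁ _)         (v₂ (b , b≢y)) = ⊥-elim (b≢y (≡y b))

singleton-K₂ : ∀ G (x : V G) → (∀ a → a ≡ x) → Embedding G K₂
singleton-K₂ G x ≡x = record
  { emb            = const true
  ; proj           = λ { true → just x ; false → nothing }
  ; partialInverse = record { retract = cong just ∘ sym ∘ ≡x ; fibre = λ { {true} refl → refl } }
  ; edges          = λ a b → mk⇔ (λ e → ⊥-elim (Graph.irrefl G (trans (≡x a) (sym (≡x b))) e))
                                 (λ t≢t → ⊥-elim (t≢t refl))
  }

-- Consequences of the order, and the three cases.

order-1 : ∀ G → order G ≡ 1 → ∀ (u v : V G) → u ≡ v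
order-1 record { order = _ ; finite = f } refl u v =
  trans (sym (strictlyInverseʳ u)) (trans (cong from′ (fin-1 (to′ u) (to′ v))) (strictlyInverseʳ v))
  where
  open Inverse f renaming (to to to′; from to from′)

  fin-1 : ∀ (i j : Fin 1) → i ≡ j
  fin-1 zero zero = refl

order>1 : ∀ G → 1 < order G → ∀ (u : V G) → ∃[ v ] v ≢ u
order>1 G@(record { order = suc (suc _) ; finite = f }) (s≤s (s≤s _)) u
  with Graph._≟_ G (Inverse.from f zero) u
... | no 0≢u   = Inverse.from f zero , 0≢u
... | yes refl = Inverse.from f (suc zero) , 1≢0
  where
  open Inverse f renaming (to to to′; from to from′)

  1≢0 : from′ (suc zero) ≢ from′ zero
  1≢0 e with () ← trans (sym (strictlyInverseˡ (suc zero))) (trans (cong to′ e) (strictlyInverseˡ zero))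

-- The vertex rules out 0 and the missing edge rules out 1.
incomplete⇒≥2 : ∀ G {j} → V G → ¬ IsComplete G → KWordRepresentable G j → 2 ≤ j
incomplete⇒≥2 G {zero}        v _   r with () ← representable⇒positive G v r
incomplete⇒≥2 G {suc zero}    _ ¬c  r = ⊥-elim (¬c (1-representable⇒complete G r))
incomplete⇒≥2 G {suc (suc _)} _ _   _ = s≤s (s≤s z≤n)

theorem16 : (G₁ G₂ : Graph) (k₁ k₂ : ℕ) →
    WordRepresentable G₁ → WordRepresentable G₂ →
    ℛ[ G₁ ]≡ k₁ → ℛ[ G₂ ]≡ k₂ →
    (x : V G₁) (y : V G₂) →
    let k  = k₁ ⊔ k₂
        G′ = connect G₁ G₂ x y
        G″ = identify G₁ G₂ x y
    in
    (order G₁ ≡ 1 × order G₂ ≡ 1 →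
       IsComplete G′ × IsComplete G″ × k₁ ≡ 1 × k₂ ≡ 1 × (ℛ[ G′ ]≡ 1) × (ℛ[ G″ ]≡ 1))
    ×
    (order G₁ ⊓ order G₂ ≡ 1 × 1 < order G₁ ⊔ order G₂ →
       (ℛ[ G″ ]≡ k) × (ℛ[ G′ ]≡ (k ⊔ 2)))
    ×
    (1 < order G₁ ⊓ order G₂ →
       (ℛ[ G′ ]≡ (k ⊔ 2)) × (ℛ[ G″ ]≡ (k ⊔ 2)))
theorem16 G₁ G₂ k₁ k₂ _ _ (r₁ , min₁) (r₂ , min₂) x y = both-trivial , one-trivial , none-trivial
  where
  k  = k₁ ⊔ k₂
  G′ = connect G₁ G₂ x y
  G″ = identify G₁ G₂ x y

  below′ : ∀ j → KWordRepresentable G′ j → k ≤ j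
  below′ j r = ⊔-lub (min₁ j (embed (connect-left G₁ G₂ x y) r)) (min₂ j (embed (connect-right G₁ G₂ x y) r))

  below″ : ∀ j → KWordRepresentable G″ j → k ≤ j
  below″ j r = ⊔-lub (min₁ j (embed (left-embedding G₁ G₂ x y) r))
                     (min₂ j (embed (right-embedding G₁ G₂ x y) r))

  r₁⁺ : KWordRepresentable G₁ (k ⊔ 2)
  r₁⁺ = representable-mono G₁ (≤-trans (m≤m⊔n k₁ k₂) (m≤m⊔n k 2)) r₁

  r₂⁺ : KWordRepresentable G₂ (k ⊔ 2)
  r₂⁺ = representable-mono G₂ (≤-trans (m≤n⊔m k₁ k₂) (m≤m⊔n k 2)) r₂

  -- Both graphs are lifted to `k ⊔ 2`, where gluing applies; induced subgraphs force `k` from below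
  -- and incompleteness forces 2.
  rep-connect : ¬ IsComplete G′ → ℛ[ G′ ]≡ (k ⊔ 2)
  rep-connect ¬c = connect-representable G₁ G₂ x y (m≤n⊔m k 2) r₁⁺ r₂⁺
    , λ j r → ⊔-lub (below′ j r) (incomplete⇒≥2 G′ (inj₁ x) ¬c r)

  rep-identify : ¬ IsComplete G″ → ℛ[ G″ ]≡ (k ⊔ 2)
  rep-identify ¬c = identify-representable G₁ G₂ x y (m≤n⊔m k 2) r₁⁺ r₂⁺
    , λ j r → ⊔-lub (below″ j r) (incomplete⇒≥2 G″ z ¬c r)

  -- A vertex of `G₁` other than `x` is not adjacent to `y`.
  ¬complete-left : 1 < order G₁ → ¬ IsComplete G′
  ¬complete-left 1<n c with a , a≢x ← order>1 G₁ 1<n x = a≢x (proj₁ (c {inj₁ a} {inj₂ y} λ ()))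

  ¬complete-right : 1 < order G₂ → ¬ IsComplete G′
  ¬complete-right 1<n c with b , b≢y ← order>1 G₂ 1<n y = b≢y (proj₂ (c {inj₁ x} {inj₂ b} λ ()))

  via-G₁ : order G₂ ≡ 1 → ∀ {j} → KWordRepresentable G₁ j → KWordRepresentable G″ j
  via-G₁ o₂ = embed (singleton-identify G₁ G₂ x y (λ b → order-1 G₂ o₂ b y))

  via-G₂ : order G₁ ≡ 1 → ∀ {j} → KWordRepresentable G₂ j → KWordRepresentable G″ j
  via-G₂ o₁ = embed (swap-embedding G₁ G₂ x y) ∘
    embed (singleton-identify G₂ G₁ y x (λ a → order-1 G₁ o₁ a x))

  both-trivial : order G₁ ≡ 1 × order G₂ ≡ 1 →
    IsComplete G′ × IsComplete G″ × k₁ ≡ 1 × k₂ ≡ 1 × (ℛ[ G′ ]≡ 1) × (ℛ[ G″ ]≡ 1)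
  both-trivial (o₁ , o₂) =
      1-representable⇒complete G′ s′
    , 1-representable⇒complete G″ s″
    , ≤-antisym (min₁ 1 s₁) (representable⇒positive G₁ x r₁)
    , ≤-antisym (min₂ 1 s₂) (representable⇒positive G₂ y r₂)
    , (s′ , λ j → representable⇒positive G′ (inj₁ x))
    , (s″ , λ j → representable⇒positive G″ z)
    where
    ≡x = λ a → order-1 G₁ o₁ a x
    ≡y = λ b → order-1 G₂ o₂ b y
    s₁ = embed (singleton-K₂ G₁ x ≡x) K₂-representable
    s₂ = embed (singleton-K₂ G₂ y ≡y) K₂-representable
    s′ = embed (singleton-connect G₁ G₂ x y ≡x ≡y) K₂-representable
    s″ = via-G₁ o₂ s₁

  one-trivial : order G₁ ⊓ order G₂ ≡ 1 × 1 < order G₁ ⊔ order G₂ →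
                (ℛ[ G″ ]≡ k) × (ℛ[ G′ ]≡ (k ⊔ 2))
  one-trivial (min≡1 , 1<max) = (r″ , below″) , rep-connect ¬c
    where
    r″ : KWordRepresentable G″ k
    -- The graph attaining the minimum is a single vertex, so `G″` embeds in the other one.
    r″ with ⊓-sel (order G₁) (order G₂)
    ... | inj₁ e = via-G₂ (trans (sym e) min≡1) (representable-mono G₂ (m≤n⊔m k₁ k₂) r₂)
    ... | inj₂ e = via-G₁ (trans (sym e) min≡1) (representable-mono G₁ (m≤m⊔n k₁ k₂) r₁)

    ¬c : ¬ IsComplete G′
    ¬c with ⊔-sel (order G₁) (order G₂)
    ... | inj₁ e = ¬complete-left (subst (1 <_) e 1<max)
    ... | inj₂ e = ¬complete-right (subst (1 <_) e 1<max)

  none-trivial : 1 < order G₁ ⊓ order G₂ → (ℛ[ G′ ]≡ (k ⊔ 2)) × (ℛ[ G″ ]≡ (k ⊔ 2))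
  none-trivial 1<min = rep-connect (¬complete-left 1<n₁) , rep-identify ¬c
    where
    1<n₁ = ≤-trans 1<min (m⊓n≤m (order G₁) (order G₂))
    1<n₂ = ≤-trans 1<min (m⊓n≤n (order G₁) (order G₂))

    ¬c : ¬ IsComplete G″
    -- Vertices on different sides of `z` have the empty type as their adjacency.
    ¬c c with p ← order>1 G₁ 1<n₁ x | q ← order>1 G₂ 1<n₂ y = c {v₁ p} {v₂ q} λ ()
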